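{- For every integer $d \geq 1$, the $\left(\lfloor \tfrac{d}{2} \rfloor + 1\right) \times d$ matrix $M_d = (m_{ij})$ with entries \[ m_{ij} = \binom{d+1-i}{d-j} - \binom{i}{d-j}, \qquad i = 0, \ldots, \lfloor \tfrac{d}{2} \rfloor, \quad j = 0, \ldots, d-1, \] is totally nonnegative.
   Context: A real matrix is called totally nonnegative if every minor of it is nonnegative, i.e. for every $k \geq 1$, every choice of $k$ rows $i_1 < \cdots < i_k$ and $k$ columns $j_1 < \cdots < j_k$, the determinant of the corresponding $k \times k$ submatrix (rows and columns kept in increasing order) is $\geq 0$. Binomial coefficients $\binom{a}{b}$ with integers $a, b \geq 0$ are the usual ones, with $\binom{a}{b} = 0$ if $b > a$. Rows of $M_d$ are indexed by $i$ and columns by $j$, in increasing order. -}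

module Defs where

open import Algebra.Properties.Semiring.Sum using (sum)
open import Data.Fin.Base as Fin using (Fin; zero; suc; toℕ; punchIn)
open import Data.Integer.Base as ℤ using (ℤ; +_; -1ℤ; 0ℤ; 1ℤ)
open import Data.Integer.Properties using (+-*-semiring)
open import Data.Nat.Base as ℕ using (ℕ; zero; suc; ⌊_/2⌋)
open import Data.Nat.Combinatorics using (_C_)
open import Data.Vec.Functional using (Vector)
open import Relation.Binary.Core using (_Preserves_⟶_)

-- Integer entries: every minor of an integer matrix is an integer, with the
-- same value and sign whether it is computed over ℤ or over the reals.
Matrix : ℕ → ℕ → Set
Matrix m n = Vector (Vector ℤ n) m

submatrix : ∀ {m n k l} → Matrix m n → (Fin k → Fin m) → (Fin l → Fin n) → Matrix k l
submatrix A r c i j = A (r i) (c j)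

-- Laplace expansion along the first row; the empty determinant is 1.
det : ∀ {n} → Matrix n n → ℤ
det {zero}  A = 1ℤ
det {suc n} A = sum +-*-semiring λ j →
  (-1ℤ ℤ.^ toℕ j) ℤ.* A zero j ℤ.* det (submatrix A suc (punchIn j))

StrictlyIncreasing : ∀ {k n} → (Fin k → Fin n) → Set
StrictlyIncreasing f = f Preserves Fin._<_ ⟶ Fin._<_

TotallyNonnegative : ∀ {m n} → Matrix m n → Set
TotallyNonnegative {m} {n} A =
  ∀ (k : ℕ) → 1 ℕ.≤ k →
  ∀ (r : Fin k → Fin m) (c : Fin k → Fin n) →
  StrictlyIncreasing r → StrictlyIncreasing c →
  0ℤ ℤ.≤ det (submatrix A r c)

-- The truncated subtractions are exact, since toℕ i ≤ ⌊ d /2⌋ and toℕ j < d;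
-- the difference of the two binomials is taken in ℤ.
M : (d : ℕ) → Matrix (⌊ d /2⌋ ℕ.+ 1) d
M d i j = + ((d ℕ.+ 1 ℕ.∸ toℕ i) C (d ℕ.∸ toℕ j)) ℤ.- + (toℕ i C (d ℕ.∸ toℕ j))

{-# OPTIONS --safe #-}
module Submission where

open import Defs
open import Data.Nat.Base using (ℕ; _≤_)
open import Algebra.Properties.Semiring.Sum using (sum; sum-cong-≗; sum-replicate-zero; ∑-distrib-+; *-distribˡ-sum)
open import Data.Empty using (⊥-elim)
open import Data.Fin.Base as Fin using (Fin; zero; suc; toℕ; punchIn; pinch; inject₁)
open import Data.Fin.Properties using (toℕ<n; suc-injective; _≟_; <-cmp; any?)
open import Data.Integer.Base as ℤ using (ℤ; +_; -_; _+_; _-_; _*_; _^_; 0ℤ; 1ℤ; -1ℤ; +≤+)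
open import Data.Integer.Properties as ℤₚ using (+-*-semiring)
open import Data.Integer.Tactic.RingSolver using (solve-∀)
open import Data.Nat.Base as ℕ using (zero; suc; pred; _∸_; _⊓_; ⌊_/2⌋; z≤n; s≤s)
open import Data.Nat.Combinatorics using (_C_; nCk+nC[k+1]≡[n+1]C[k+1])
import Data.Nat.Properties as ℕₚ
open import Data.Product using (∃; _×_; _,_)
open import Data.Sum using (_⊎_; inj₁; inj₂)
open import Data.Vec.Functional using (Vector; updateAt)
open import Data.Vec.Functional.Properties using (updateAt-updates; updateAt-minimal)
open import Function using (_∘_; const)
open import Relation.Binary.Definitions using (tri<; tri≈; tri>)
open import Relation.Binary.PropositionalEquality
open import Relation.Nullary using (yes; no)

-- Reverse the order of rows and columns, and read a row as the coefficient
-- sequence of a polynomial. For d = 2n + ε with ε ∈ {0, 1}, row m = n - i is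
-- p n m = (1+x)^(n+ε+m+1) - (1+x)^(n-m). Put q n m = (1+x)^(n+ε+m) + (1+x)^(n-m).
-- Then
--   p n (m+1) = p n m + x q n (m+1),   q (n+1) (m+1) = q (n+1) m + x p n m,
-- so unfolding the recursion writes M_d as a product of nonnegative bidiagonal
-- matrices applied to the rows p (n-m) 0 shifted by x^(2m), that is, to
-- x^(2m+1) (1+x)^(n-m), times 2+x when ε = 1. By Pascal's rule these come from
-- the monomials in the same way. Adding a nonnegative multiple of a row to an
-- adjacent one preserves total nonnegativity: by multilinearity a minor becomes
-- a nonnegative combination of minors of the old matrix, where those with two
-- equal rows vanish. The term q n 0 occurs halved when ε = 0.

private
  ∑ : ∀ {n} → Vector ℤ n → ℤ
  ∑ = sum +-*-semiring

∑-zero : ∀ {n} {f : Vector ℤ n} → (∀ j → f j ≡ 0ℤ) → ∑ f ≡ 0ℤ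
∑-zero {n} f≗0 = trans (sum-cong-≗ +-*-semiring f≗0) (sum-replicate-zero +-*-semiring n)

∑-linear : ∀ {n} α β (f g : Vector ℤ n) →
           ∑ (λ j → α * f j + β * g j) ≡ α * ∑ f + β * ∑ g
∑-linear α β f g = trans (∑-distrib-+ +-*-semiring (λ j → α * f j) (λ j → β * g j))
  (sym (cong₂ _+_ (*-distribˡ-sum +-*-semiring α f) (*-distribˡ-sum +-*-semiring β g)))

-- Determinants

private
  sign : ∀ {n} → Fin n → ℤ
  sign j = -1ℤ ^ toℕ j

  minor : ∀ {n} → Matrix (suc n) (suc n) → Fin (suc n) → ℤ
  minor A j = det (submatrix A suc (punchIn j))

det-cong : ∀ {n} {A B : Matrix n n} → (∀ i j → A i j ≡ B i j) → det A ≡ det B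
det-cong {zero}  A≗B = refl
det-cong {suc n} A≗B = sum-cong-≗ +-*-semiring λ j →
  cong₂ (λ a d → sign j * a * d) (A≗B zero j) (det-cong (λ i l → A≗B (suc i) (punchIn j l)))

-- In the expansion along the first row, the combination sits in the entries when `t` is `zero`, and
-- otherwise in every minor, where induction applies.
det-linear : ∀ {n} (t : Fin n) α β (A U V : Matrix n n) →
  (∀ i → i ≢ t → ∀ j → A i j ≡ U i j) →
  (∀ i → i ≢ t → ∀ j → A i j ≡ V i j) →
  (∀ j → A t j ≡ α * U t j + β * V t j) →
  det A ≡ α * det U + β * det V
det-linear {suc n} zero α β A U V A≗U A≗V A₀ = trans
  (sum-cong-≗ +-*-semiring λ j → begin
    sign j * A zero j * minor A j
      ≡⟨ cong (λ a → sign j * a * minor A j) (A₀ j) ⟩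
    sign j * (α * U zero j + β * V zero j) * minor A j
      ≡⟨ distribute (sign j) α β (U zero j) (V zero j) (minor A j) ⟩
    α * (sign j * U zero j * minor A j) + β * (sign j * V zero j * minor A j)
      ≡⟨ cong₂ (λ x y → α * (sign j * U zero j * x) + β * (sign j * V zero j * y))
           (det-cong (λ i l → A≗U (suc i) (λ ()) (punchIn j l)))
           (det-cong (λ i l → A≗V (suc i) (λ ()) (punchIn j l))) ⟩
    α * (sign j * U zero j * minor U j) + β * (sign j * V zero j * minor V j) ∎)
  (∑-linear α β (λ j → sign j * U zero j * minor U j) (λ j → sign j * V zero j * minor V j))
  where
  open ≡-Reasoning
  distribute : ∀ s α β u v d → s * (α * u + β * v) * d ≡ α * (s * u * d) + β * (s * v * d)
  distribute = solve-∀
det-linear {suc n} (suc t) α β A U V A≗U A≗V Aₜ = trans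
  (sum-cong-≗ +-*-semiring λ j → begin
    sign j * A zero j * minor A j
      ≡⟨ cong (sign j * A zero j *_) (det-linear t α β _ _ _
           (λ i i≢t l → A≗U (suc i) (i≢t ∘ suc-injective) (punchIn j l))
           (λ i i≢t l → A≗V (suc i) (i≢t ∘ suc-injective) (punchIn j l))
           (Aₜ ∘ punchIn j)) ⟩
    sign j * A zero j * (α * minor U j + β * minor V j)
      ≡⟨ distribute (sign j) (A zero j) α β (minor U j) (minor V j) ⟩
    α * (sign j * A zero j * minor U j) + β * (sign j * A zero j * minor V j)
      ≡⟨ cong₂ (λ x y → α * (sign j * x * minor U j) + β * (sign j * y * minor V j))
           (A≗U zero (λ ()) j) (A≗V zero (λ ()) j) ⟩
    α * (sign j * U zero j * minor U j) + β * (sign j * V zero j * minor V j) ∎)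
  (∑-linear α β (λ j → sign j * U zero j * minor U j) (λ j → sign j * V zero j * minor V j))
  where
  open ≡-Reasoning
  distribute : ∀ s a α β u v → s * a * (α * u + β * v) ≡ α * (s * a * u) + β * (s * a * v)
  distribute = solve-∀

-- (j , k) ↦ (punchIn j k , pinch k j) swaps the two columns removed by
-- deleting j and then k.
punchIn-pinch : ∀ {n} (j : Fin (suc n)) (k : Fin n) → punchIn (punchIn j k) (pinch k j) ≡ j
punchIn-pinch zero    zero    = refl
punchIn-pinch zero    (suc k) = refl
punchIn-pinch (suc j) zero    = refl
punchIn-pinch (suc j) (suc k) = cong suc (punchIn-pinch j k)

punchIn-swap : ∀ {n} (j : Fin (suc (suc n))) (k : Fin (suc n)) (x : Fin n) →
  punchIn (punchIn j k) (punchIn (pinch k j) x) ≡ punchIn j (punchIn k x)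
punchIn-swap zero    zero    x       = refl
punchIn-swap zero    (suc k) x       = refl
punchIn-swap (suc j) zero    x       = refl
punchIn-swap (suc j) (suc k) zero    = refl
punchIn-swap (suc j) (suc k) (suc x) = cong suc (punchIn-swap j k x)

-- The sign in a Laplace expansion along two rows: deleting the same two columns in the other order
-- changes the number of columns skipped by exactly one.
sign-swap : ∀ {n} (j : Fin (suc n)) (k : Fin n) →
  sign (punchIn j k) * sign (pinch k j) ≡ - (sign j * sign k)
sign-swap {suc n} zero k = flip (sign k)
  where
  flip : ∀ x → (-1ℤ * x) * 1ℤ ≡ - (1ℤ * x)
  flip = solve-∀
sign-swap (suc j) zero = flip (sign j)
  where
  flip : ∀ x → 1ℤ * x ≡ - ((-1ℤ * x) * 1ℤ)
  flip = solve-∀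
sign-swap (suc j) (suc k) = begin
  (-1ℤ * x′) * (-1ℤ * y′) ≡⟨ cancel x′ y′ ⟩
  x′ * y′                 ≡⟨ sign-swap j k ⟩
  - (x * y)               ≡⟨ cong -_ (cancel x y) ⟨
  - ((-1ℤ * x) * (-1ℤ * y)) ∎
  where
  open ≡-Reasoning
  x = sign j
  y = sign k
  x′ = sign (punchIn j k)
  y′ = sign (pinch k j)
  cancel : ∀ a b → (-1ℤ * a) * (-1ℤ * b) ≡ a * b
  cancel = solve-∀

-- The swap pairs `(zero , k)` with `(suc k , zero)`, so the first row and first column of the index
-- set cancel. On the remaining indices it is the same swap one size smaller.
∑∑-antisymmetric : ∀ {n} (G : Fin (suc n) → Fin n → ℤ) →
  (∀ j k → G (punchIn j k) (pinch k j) ≡ - G j k) → ∑ (λ j → ∑ (G j)) ≡ 0ℤ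
∑∑-antisymmetric {zero}  G anti = refl
∑∑-antisymmetric {suc n} G anti = begin
  ∑ (G zero) + ∑ (λ j → G (suc j) zero + ∑ (G′ j))
    ≡⟨ cong (_+_ (∑ (G zero))) (∑-distrib-+ +-*-semiring (λ j → G (suc j) zero) (∑ ∘ G′)) ⟩
  ∑ (G zero) + (∑ (λ j → G (suc j) zero) + ∑ (∑ ∘ G′))
    ≡⟨ ℤₚ.+-assoc (∑ (G zero)) _ _ ⟨
  (∑ (G zero) + ∑ (λ j → G (suc j) zero)) + ∑ (∑ ∘ G′)
    ≡⟨ cong₂ _+_
         (trans (sym (∑-distrib-+ +-*-semiring (G zero) (λ j → G (suc j) zero))) (∑-zero cancel))
         (∑∑-antisymmetric G′ (λ j k → anti (suc j) (suc k))) ⟩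
  0ℤ ∎
  where
  open ≡-Reasoning
  G′ : Fin (suc n) → Fin n → ℤ
  G′ j k = G (suc j) (suc k)
  cancel : ∀ j → G zero j + G (suc j) zero ≡ 0ℤ
  cancel j = trans (cong (_+_ (G zero j)) (anti zero j)) (ℤₚ.+-inverseʳ (G zero j))

-- For the top two rows, expand along both: the swap of the two deleted columns fixes the
-- complementary minor and the product of entries but flips the sign. A lower pair survives in every
-- minor of the first-row expansion.
det-adjacent-equal : ∀ {n} (i : Fin n) (A : Matrix (suc n) (suc n)) →
  (∀ j → A (inject₁ i) j ≡ A (suc i) j) → det A ≡ 0ℤ
det-adjacent-equal {suc n} zero A A₀≗A₁ = trans
  (sum-cong-≗ +-*-semiring λ j →
    *-distribˡ-sum +-*-semiring (sign j * A zero j) (λ k → sign k * A (suc zero) (punchIn j k) * D j k))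
  (∑∑-antisymmetric G anti)
  where
  open ≡-Reasoning
  D : Fin (suc (suc n)) → Fin (suc n) → ℤ
  D j k = det (submatrix A (λ i → suc (suc i)) (punchIn j ∘ punchIn k))
  G : Fin (suc (suc n)) → Fin (suc n) → ℤ
  G j k = sign j * A zero j * (sign k * A (suc zero) (punchIn j k) * D j k)
  regroup : ∀ x a y b d → x * a * (y * b * d) ≡ (x * y) * (a * b * d)
  regroup = solve-∀
  regroup⁻ : ∀ x a y b d → - (x * y) * (b * a * d) ≡ - (x * a * (y * b * d))
  regroup⁻ = solve-∀
  anti : ∀ j k → G (punchIn j k) (pinch k j) ≡ - G j k
  anti j k = begin
    G (punchIn j k) (pinch k j)
      ≡⟨ regroup (sign (punchIn j k)) _ (sign (pinch k j)) _ _ ⟩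
    sign (punchIn j k) * sign (pinch k j) *
      (A zero (punchIn j k) * A (suc zero) (punchIn (punchIn j k) (pinch k j)) * D (punchIn j k) (pinch k j))
      ≡⟨ cong₂ _*_ (sign-swap j k) (cong₂ _*_
           (cong₂ _*_ (A₀≗A₁ (punchIn j k))
             (trans (cong (A (suc zero)) (punchIn-pinch j k)) (sym (A₀≗A₁ j))))
           (det-cong (λ i l → cong (A (suc (suc i))) (punchIn-swap j k l)))) ⟩
    - (sign j * sign k) * (A (suc zero) (punchIn j k) * A zero j * D j k)
      ≡⟨ regroup⁻ (sign j) (A zero j) (sign k) (A (suc zero) (punchIn j k)) (D j k) ⟩
    - G j k ∎
det-adjacent-equal {suc n} (suc i) A Aᵢ≗Aᵢ₊₁ = ∑-zero λ j → trans
  (cong (sign j * A zero j *_)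
    (det-adjacent-equal i (submatrix A suc (punchIn j)) (Aᵢ≗Aᵢ₊₁ ∘ punchIn j)))
  (ℤₚ.*-zeroʳ (sign j * A zero j))

det-zero-row : ∀ {n} (A : Matrix (suc n) (suc n)) → (∀ j → A zero j ≡ 0ℤ) → det A ≡ 0ℤ
det-zero-row A A₀≗0 = ∑-zero λ j → trans
  (cong (λ a → sign j * a * minor A j) (A₀≗0 j))
  (annihilate (sign j) _)
  where
  annihilate : ∀ s d → s * 0ℤ * d ≡ 0ℤ
  annihilate = solve-∀

-- The expansion runs along the first row, so induction is needed: deleting a column `suc j` leaves
-- the zero column in first position.
det-zero-column : ∀ {n} (A : Matrix (suc n) (suc n)) → (∀ i → A i zero ≡ 0ℤ) → det A ≡ 0ℤ
det-zero-column {n} A A⁰≗0 = ∑-zero (term n A A⁰≗0)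
  where
  annihilate : ∀ s d → s * 0ℤ * d ≡ 0ℤ
  annihilate = solve-∀
  term : ∀ n (A : Matrix (suc n) (suc n)) → (∀ i → A i zero ≡ 0ℤ) → ∀ j →
         sign j * A zero j * minor A j ≡ 0ℤ
  term n A A⁰≗0 zero = trans
    (cong (λ a → 1ℤ * a * minor A zero) (A⁰≗0 zero)) (annihilate 1ℤ (minor A zero))
  term (suc n) A A⁰≗0 (suc j) = trans
    (cong (sign (suc j) * A zero (suc j) *_)
      (∑-zero (term n (submatrix A suc (punchIn (suc j))) (A⁰≗0 ∘ suc))))
    (ℤₚ.*-zeroʳ (sign (suc j) * A zero (suc j)))

det-unit-row : ∀ {n} (A : Matrix (suc n) (suc n)) → A zero zero ≡ 1ℤ → (∀ j → A zero (suc j) ≡ 0ℤ) →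
  det A ≡ det (submatrix A suc suc)
det-unit-row A A₀₀ A₀≗0 = begin
  1ℤ * A zero zero * minor A zero + ∑ rest
    ≡⟨ cong₂ (λ a b → 1ℤ * a * minor A zero + b) A₀₀ (∑-zero λ j → trans
         (cong (λ a → sign (suc j) * a * minor A (suc j)) (A₀≗0 j))
         (annihilate (sign (suc j)) _)) ⟩
  1ℤ * 1ℤ * minor A zero + 0ℤ
    ≡⟨ simplify (minor A zero) ⟩
  minor A zero ∎
  where
  open ≡-Reasoning
  rest : Vector ℤ _
  rest j = sign (suc j) * A zero (suc j) * minor A (suc j)
  annihilate : ∀ s d → s * 0ℤ * d ≡ 0ℤ
  annihilate = solve-∀
  simplify : ∀ d → 1ℤ * 1ℤ * d + 0ℤ ≡ d
  simplify = solve-∀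

-- Totally nonnegative infinite matrices

Row : Set
Row = ℕ → ℤ

Decreasing : ∀ {k} → (Fin k → ℕ) → Set
Decreasing f = ∀ i j → i Fin.< j → f j ℕ.< f i

WeaklyDecreasing : ∀ {k} → (Fin k → ℕ) → Set
WeaklyDecreasing f = ∀ i j → i Fin.< j → f j ≤ f i

-- Minors of infinite matrices, with rows and columns both listed in
-- decreasing order: reversing both orders does not change a minor.
TN : (ℕ → Row) → Set
TN A = ∀ k (r c : Fin k → ℕ) → Decreasing r → Decreasing c → 0ℤ ℤ.≤ det (λ i j → A (r i) (c j))

Decreasing-tail : ∀ {k} {f : Fin (suc k) → ℕ} → Decreasing f → Decreasing (f ∘ suc)
Decreasing-tail f↓ i j i<j = f↓ (suc i) (suc j) (s≤s i<j)

tail≤head : ∀ {k} {f : Fin (suc k) → ℕ} → Decreasing f → ∀ i → f i ≤ f zero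
tail≤head f↓ zero    = ℕₚ.≤-refl
tail≤head f↓ (suc i) = ℕₚ.<⇒≤ (f↓ zero (suc i) (s≤s z≤n))

decreasing-or-tie : ∀ {k} (f : Fin (suc k) → ℕ) → WeaklyDecreasing f →
  Decreasing f ⊎ ∃ λ i → f (inject₁ i) ≡ f (suc i)
decreasing-or-tie {zero}  f f↓ = inj₁ λ where zero zero ()
decreasing-or-tie {suc k} f f↓
  with decreasing-or-tie (f ∘ suc) (λ i j i<j → f↓ (suc i) (suc j) (s≤s i<j)) | f zero ℕₚ.≟ f (suc zero)
... | inj₂ (i , tie) | _       = inj₂ (suc i , tie)
... | inj₁ _         | yes tie = inj₂ (zero , tie)
... | inj₁ tail↓     | no f₀≢f₁ = inj₁ strict
  where
  strict : Decreasing f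
  strict zero    (suc j) _         =
    ℕₚ.≤-<-trans (tail≤head tail↓ j) (ℕₚ.≤∧≢⇒< (f↓ zero (suc zero) (s≤s z≤n)) (f₀≢f₁ ∘ sym))
  strict (suc i) (suc j) (s≤s i<j) = tail↓ i j i<j

TN-cong : ∀ {A B : ℕ → Row} → (∀ m → A m ≗ B m) → TN A → TN B
TN-cong A≗B tn k r c r↓ c↓ = subst (0ℤ ℤ.≤_) (det-cong λ i j → A≗B (r i) (c j)) (tn k r c r↓ c↓)

-- A repetition in a weakly decreasing selection already occurs at two neighbouring positions, and
-- then the minor vanishes.
TN-weak : ∀ {A : ℕ → Row} → TN A → ∀ {k} (r c : Fin k → ℕ) → WeaklyDecreasing r → Decreasing c →
  0ℤ ℤ.≤ det (λ i j → A (r i) (c j))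
TN-weak tn {zero}  r c r↓ c↓ = +≤+ z≤n
TN-weak {A} tn {suc k} r c r↓ c↓ with decreasing-or-tie r r↓
... | inj₁ r⇓        = tn (suc k) r c r⇓ c↓
... | inj₂ (i , tie) = ℤₚ.≤-reflexive (sym
  (det-adjacent-equal i (λ i j → A (r i) (c j)) (λ j → cong (λ m → A m (c j)) tie)))

TN-select : ∀ {A : ℕ → Row} (f : ℕ → ℕ) → (∀ {m n} → m ℕ.< n → f m ℕ.< f n) → TN A → TN (A ∘ f)
TN-select f f↑ tn k r c r↓ c↓ = tn k (f ∘ r) c (λ i j → f↑ ∘ r↓ i j) c↓

-- Row operations

+-nonneg : ∀ {a b} → 0ℤ ℤ.≤ a → 0ℤ ℤ.≤ b → 0ℤ ℤ.≤ a + b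
+-nonneg = ℤₚ.+-mono-≤

*-nonneg : ∀ n {a} → 0ℤ ℤ.≤ a → 0ℤ ℤ.≤ + n * a
*-nonneg n {a} 0≤a = subst (ℤ._≤ + n * a) (ℤₚ.*-zeroʳ (+ n)) (ℤₚ.*-monoˡ-≤-nonNeg (+ n) 0≤a)

-- A minor that uses row `s` splits by linearity into `α` times the old minor and `β` times the
-- minor with `s` replaced by `s′`. The two bounds say that `s` and `s′` differ by at most one:
-- selected indices below `s` are at most `s′`, and those above `s` are at least `s′`, so the new
-- selection is still weakly decreasing.
TN-row-operation : ∀ {A B : ℕ → Row} s s′ α β → s ≤ suc s′ → s′ ≤ suc s →
  (∀ m → m ≢ s → B m ≗ A m) → (∀ e → B s e ≡ + α * A s e + + β * A s′ e) → TN A → TN B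
TN-row-operation {A} {B} s s′ α β s≤1+s′ s′≤1+s B≗A Bₛ tn k r c r↓ c↓ with any? (λ t → r t ℕₚ.≟ s)
... | no ∄t = subst (0ℤ ℤ.≤_)
  (det-cong λ i j → sym (B≗A (r i) (λ rᵢ≡s → ∄t (i , rᵢ≡s)) (c j))) (tn k r c r↓ c↓)
... | yes (t , refl) = subst (0ℤ ℤ.≤_) (sym expansion)
  (+-nonneg (*-nonneg α (tn k r c r↓ c↓)) (*-nonneg β (TN-weak {A} tn r′ c r′↓ c↓)))
  where
  r′ : Fin k → ℕ
  r′ = updateAt r t (const s′)

  r-injective : ∀ i → i ≢ t → r i ≢ r t
  r-injective i i≢t rᵢ≡rₜ with <-cmp i t
  ... | tri< i<t _ _ = ℕₚ.<⇒≢ (r↓ i t i<t) (sym rᵢ≡rₜ)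
  ... | tri≈ _ i≡t _ = i≢t i≡t
  ... | tri> _ _ t<i = ℕₚ.<⇒≢ (r↓ t i t<i) rᵢ≡rₜ

  expansion : det (λ i j → B (r i) (c j)) ≡
    + α * det (λ i j → A (r i) (c j)) + + β * det (λ i j → A (r′ i) (c j))
  expansion = det-linear t (+ α) (+ β) _ _ _
    (λ i i≢t j → B≗A (r i) (r-injective i i≢t) (c j))
    (λ i i≢t j → trans (B≗A (r i) (r-injective i i≢t) (c j))
      (cong (λ m → A m (c j)) (sym (updateAt-minimal i t r i≢t))))
    (λ j → trans (Bₛ (c j)) (cong (λ m → + α * A (r t) (c j) + + β * A m (c j))
      (sym (updateAt-updates t r))))

  r′↓ : WeaklyDecreasing r′
  r′↓ i j i<j with i ≟ t | j ≟ t
  ... | yes refl | yes refl = ⊥-elim (ℕₚ.<-irrefl refl i<j)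
  ... | yes refl | no j≢t
    rewrite updateAt-updates t {const s′} r | updateAt-minimal j t {const s′} r j≢t
    = ℕₚ.≤-pred (ℕₚ.≤-trans (r↓ t j i<j) s≤1+s′)
  ... | no i≢t | yes refl
    rewrite updateAt-updates t {const s′} r | updateAt-minimal i t {const s′} r i≢t
    = ℕₚ.≤-trans s′≤1+s (r↓ i t i<j)
  ... | no i≢t | no j≢t
    rewrite updateAt-minimal i t {const s′} r i≢t | updateAt-minimal j t {const s′} r j≢t
    = ℕₚ.<⇒≤ (r↓ i j i<j)

splice : ℕ → (A B : ℕ → Row) → ℕ → Row
splice zero    A B m       = A m
splice (suc s) A B zero    = B zero
splice (suc s) A B (suc m) = splice s (A ∘ suc) (B ∘ suc) m

splice-< : ∀ {s m} A B → m ℕ.< s → splice s A B m ≡ B m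
splice-< {suc s} {zero}  A B _         = refl
splice-< {suc s} {suc m} A B (s≤s m<s) = splice-< (A ∘ suc) (B ∘ suc) m<s

splice-≥ : ∀ {s m} A B → s ≤ m → splice s A B m ≡ A m
splice-≥ A B z≤n       = refl
splice-≥ A B (s≤s s≤m) = splice-≥ (A ∘ suc) (B ∘ suc) s≤m

splice-step : ∀ s m A B → m ≢ s → splice (suc s) A B m ≡ splice s A B m
splice-step s m A B m≢s with ℕₚ.<-cmp m s
... | tri< m<s _ _ = trans (splice-< A B (ℕₚ.m<n⇒m<1+n m<s)) (sym (splice-< A B m<s))
... | tri≈ _ m≡s _ = ⊥-elim (m≢s m≡s)
... | tri> _ _ s<m = trans (splice-≥ A B s<m) (sym (splice-≥ A B (ℕₚ.<⇒≤ s<m)))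

-- `splice s A B` is the state once rows `0` to `s - 1` have been replaced. The operation on row `s`
-- therefore sees the new row when `s′ < s` and the old one otherwise.
TN-sweep : ∀ {A B : ℕ → Row} →
  (∀ s → ∃ λ s′ → ∃ λ α → ∃ λ β → s ≤ suc s′ × s′ ≤ suc s ×
    (∀ e → B s e ≡ + α * A s e + + β * splice s A B s′ e)) →
  TN A → TN B
TN-sweep {A} {B} step tn zero    r c r↓ c↓ = +≤+ z≤n
-- The largest selected row is `r zero`, so after `suc (r zero)` operations the minor agrees with
-- that of `B`.
TN-sweep {A} {B} step tn (suc k) r c r↓ c↓ = subst (0ℤ ℤ.≤_)
  (det-cong λ i j → cong (λ row → row (c j)) (splice-< A B (s≤s (tail≤head r↓ i))))
  (TN-splice (suc (r zero)) (suc k) r c r↓ c↓)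
  where
  TN-splice : ∀ s → TN (splice s A B)
  TN-splice zero    = tn
  TN-splice (suc s) with s′ , α , β , s≤1+s′ , s′≤1+s , Bₛ ← step s =
    TN-row-operation s s′ α β s≤1+s′ s′≤1+s
      (λ m m≢s e → cong (λ row → row e) (splice-step s m A B m≢s))
      (λ e → trans (cong (λ row → row e) (splice-< {suc s} A B ℕₚ.≤-refl))
        (trans (Bₛ e)
          (cong (λ row → + α * row e + + β * splice s A B s′ e) (sym (splice-≥ {s} A B ℕₚ.≤-refl)))))
      (TN-splice s)

TN-bidiagonal : ∀ {A B : ℕ → Row} →
  (∀ s → ∃ λ α → ∃ λ β → ∀ e → B s e ≡ + α * A s e + + β * A (suc s) e) → TN A → TN B
TN-bidiagonal {A} {B} step = TN-sweep {A} {B} λ s → let α , β , Bₛ = step s in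
  suc s , α , β , ℕₚ.m≤n⇒m≤1+n (ℕₚ.n≤1+n s) , ℕₚ.≤-refl , λ e →
  trans (Bₛ e) (cong (λ row → + α * A s e + + β * row e) (sym (splice-≥ {s} A B (ℕₚ.n≤1+n s))))

-- Multiplication by the inverse of a lower bidiagonal matrix with entries `- w m` below a unit
-- diagonal. The recursions for p and q in m have this form.
accumulate : (ℕ → ℕ) → (ℕ → Row) → ℕ → Row
accumulate w A zero    e = A zero e
accumulate w A (suc m) e = + w m * accumulate w A m e + A (suc m) e

TN-accumulate : ∀ w {A} → TN A → TN (accumulate w A)
TN-accumulate w {A} = TN-sweep {A} {accumulate w A} λ
  -- Row `zero` has no predecessor; it stands in for one with weight 0.
  { zero    → zero , 1 , 0 , z≤n , z≤n , λ e → single (A 0 e)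
  ; (suc s) → s , 1 , w s , ℕₚ.≤-refl , ℕₚ.m≤n⇒m≤1+n (ℕₚ.n≤1+n s) , λ e → trans
    (swap (+ w s * accumulate w A s e) (A (suc s) e))
    (cong (λ row → 1ℤ * A (suc s) e + + w s * row e) (sym (splice-< {suc s} A (accumulate w A) ℕₚ.≤-refl)))
  }
  where
  single : ∀ a → a ≡ 1ℤ * a + 0ℤ * a
  single = solve-∀
  swap : ∀ a b → a + b ≡ 1ℤ * b + a
  swap = solve-∀

-- Coefficient sequences of polynomials

X : Row → Row
X f zero    = 0ℤ
X f (suc e) = f e

_^X_ : ℕ → Row → Row
zero  ^X f = f
suc a ^X f = X (a ^X f)

δ : Row
δ zero    = 1ℤ
δ (suc e) = 0ℤ

monomial-diagonal : ∀ a → (a ^X δ) a ≡ 1ℤ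
monomial-diagonal zero    = refl
monomial-diagonal (suc a) = monomial-diagonal a

monomial-off-diagonal : ∀ a e → a ≢ e → (a ^X δ) e ≡ 0ℤ
monomial-off-diagonal zero    zero    a≢e = ⊥-elim (a≢e refl)
monomial-off-diagonal zero    (suc e) a≢e = refl
monomial-off-diagonal (suc a) zero    a≢e = refl
monomial-off-diagonal (suc a) (suc e) a≢e = monomial-off-diagonal a e (a≢e ∘ cong suc)

-- This is the identity matrix. Compare the largest row and column indices: if they differ, the
-- larger one gives a zero row or a zero column; if they agree, the first row is a unit vector and
-- can be split off.
TN-monomials : TN (_^X δ)
TN-monomials zero    r c r↓ c↓ = +≤+ z≤n
TN-monomials (suc k) r c r↓ c↓ with ℕₚ.<-cmp (r zero) (c zero)
... | tri< r₀<c₀ _ _ = ℤₚ.≤-reflexive (sym (det-zero-column (λ i j → (r i ^X δ) (c j)) λ i →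
  monomial-off-diagonal (r i) (c zero) (ℕₚ.<⇒≢ (ℕₚ.≤-<-trans (tail≤head r↓ i) r₀<c₀))))
... | tri> _ _ c₀<r₀ = ℤₚ.≤-reflexive (sym (det-zero-row (λ i j → (r i ^X δ) (c j)) λ j →
  monomial-off-diagonal (r zero) (c j) (ℕₚ.<⇒≢ (ℕₚ.≤-<-trans (tail≤head c↓ j) c₀<r₀) ∘ sym)))
... | tri≈ _ r₀≡c₀ _ = subst (0ℤ ℤ.≤_)
  (sym (det-unit-row (λ i j → (r i ^X δ) (c j))
    (trans (cong (r zero ^X δ) (sym r₀≡c₀)) (monomial-diagonal (r zero)))
    (λ j → monomial-off-diagonal (r zero) (c (suc j))
      (ℕₚ.<⇒≢ (subst (c (suc j) ℕ.<_) (sym r₀≡c₀) (c↓ zero (suc j) (s≤s z≤n))) ∘ sym))))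
  (TN-monomials k (r ∘ suc) (c ∘ suc) (Decreasing-tail r↓) (Decreasing-tail c↓))

X-cong : ∀ {f g : Row} → f ≗ g → X f ≗ X g
X-cong f≗g zero    = refl
X-cong f≗g (suc e) = f≗g e

X-linear : ∀ α β (f g : Row) → X (λ e → α * f e + β * g e) ≗ λ e → α * X f e + β * X g e
X-linear α β f g zero    = vanish α β
  where
  vanish : ∀ α β → 0ℤ ≡ α * 0ℤ + β * 0ℤ
  vanish = solve-∀
X-linear α β f g (suc e) = refl

^X-linear : ∀ a α β (f g : Row) →
  a ^X (λ e → α * f e + β * g e) ≗ λ e → α * (a ^X f) e + β * (a ^X g) e
^X-linear zero    α β f g e = refl
^X-linear (suc a) α β f g e = trans (X-cong (^X-linear a α β f g) e) (X-linear α β (a ^X f) (a ^X g) e)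

^X-X : ∀ a f → a ^X X f ≗ suc a ^X f
^X-X zero    f = λ _ → refl
^X-X (suc a) f = X-cong (^X-X a f)

-- The explicit factors `1ℤ` make the recursion an instance of `X-linear` and `^X-linear` by
-- definition.
[1+x]^_ : ℕ → Row
([1+x]^ zero)  = δ
([1+x]^ suc n) e = 1ℤ * ([1+x]^ n) e + 1ℤ * X ([1+x]^ n) e

[1+x]^-coefficient : ∀ n e → ([1+x]^ n) e ≡ + (n C e)
[1+x]^-coefficient zero    zero    = refl
[1+x]^-coefficient zero    (suc e) = refl
[1+x]^-coefficient (suc n) zero    = cong (λ a → 1ℤ * a + 1ℤ * 0ℤ) ([1+x]^-coefficient n zero)
[1+x]^-coefficient (suc n) (suc e) = begin
  1ℤ * ([1+x]^ n) (suc e) + 1ℤ * ([1+x]^ n) e ≡⟨ swap (([1+x]^ n) (suc e)) (([1+x]^ n) e) ⟩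
  ([1+x]^ n) e + ([1+x]^ n) (suc e)
    ≡⟨ cong₂ _+_ ([1+x]^-coefficient n e) ([1+x]^-coefficient n (suc e)) ⟩
  + (n C e ℕ.+ n C suc e)                     ≡⟨ cong +_ (nCk+nC[k+1]≡[n+1]C[k+1] n e) ⟩
  + (suc n C suc e)                           ∎
  where
  open ≡-Reasoning
  swap : ∀ a b → 1ℤ * a + 1ℤ * b ≡ b + a
  swap = solve-∀

-- The exponent of 1 + x drops by at most one from each row to the next, so
-- x^a (1+x)^(b+1) = x^a (1+x)^b + x^(a+1) (1+x)^b raises it one unit at a time.
TN-staircase : ∀ n t → TN (λ a → suc a ^X ([1+x]^ (t ⊓ (n ∸ ⌊ a /2⌋))))
TN-staircase n zero    = TN-select {_^X δ} suc s≤s TN-monomials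
TN-staircase n (suc t) = TN-bidiagonal step (TN-staircase n t)
  where
  b : ℕ → ℕ
  b a = n ∸ ⌊ a /2⌋
  b-drop : ∀ a → pred (b a) ≤ b (suc a)
  b-drop a = subst (_≤ b (suc a)) (sym (ℕₚ.pred[m∸n]≡m∸[1+n] n ⌊ a /2⌋))
    (ℕₚ.∸-monoʳ-≤ n (ℕₚ.⌊n/2⌋-mono (ℕₚ.n≤1+n (suc a))))
  keep : ∀ u v → u ≡ 1ℤ * u + 0ℤ * v
  keep = solve-∀
  step : ∀ a → ∃ λ α → ∃ λ β → ∀ e → (suc a ^X ([1+x]^ (suc t ⊓ b a))) e ≡
    + α * (suc a ^X ([1+x]^ (t ⊓ b a))) e + + β * (suc (suc a) ^X ([1+x]^ (t ⊓ b (suc a)))) e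
  step a with t ℕₚ.<? b a
  -- Row `a` is raised from exponent `t` to `suc t`. By `b-drop` the next row has exponent exactly
  -- `t` at this stage, as Pascal's rule requires.
  ... | yes t<b
    rewrite ℕₚ.m≤n⇒m⊓n≡m t<b | ℕₚ.m≤n⇒m⊓n≡m (ℕₚ.<⇒≤ t<b)
          | ℕₚ.m≤n⇒m⊓n≡m (ℕₚ.≤-trans (ℕₚ.<⇒≤pred t<b) (b-drop a))
    = 1 , 1 , λ e → trans (^X-linear (suc a) 1ℤ 1ℤ ([1+x]^ t) (X ([1+x]^ t)) e)
        (cong (λ z → 1ℤ * (suc a ^X ([1+x]^ t)) e + 1ℤ * z) (^X-X (suc a) ([1+x]^ t) e))
  -- Row `a` has already reached its final exponent `b a`.
  ... | no t≮b
    rewrite ℕₚ.m≥n⇒m⊓n≡n (ℕₚ.≮⇒≥ t≮b) | ℕₚ.m≥n⇒m⊓n≡n (ℕₚ.m≤n⇒m≤1+n (ℕₚ.≮⇒≥ t≮b))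
    = 1 , 0 , λ e → keep ((suc a ^X ([1+x]^ b a)) e) ((suc (suc a) ^X ([1+x]^ (t ⊓ b (suc a)))) e)

-- The factorisation

-- The exponent `suc (m + m)` combines the shift x^(2m) with the factor x of p (n-m) 0 = x g (n-m).
seeds : (ℕ → Row) → ℕ → ℕ → Row
seeds g n m = suc (m ℕ.+ m) ^X g (n ∸ m)

double-< : ∀ {m n} → m ℕ.< n → m ℕ.+ m ℕ.< n ℕ.+ n
double-< m<n = ℕₚ.+-mono-< m<n m<n

TN-even-seeds : ∀ n → TN (seeds [1+x]^_ n)
TN-even-seeds n = TN-cong same (TN-select {E} (λ m → m ℕ.+ m) double-< (TN-staircase n n))
  where
  E : ℕ → Row
  E a = suc a ^X ([1+x]^ (n ⊓ (n ∸ ⌊ a /2⌋)))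
  same : ∀ m → E (m ℕ.+ m) ≗ seeds [1+x]^_ n m
  same m e rewrite sym (ℕₚ.n≡⌊n+n/2⌋ m) | ℕₚ.m≥n⇒m⊓n≡n (ℕₚ.m∸n≤m n m) = refl

[2+x][1+x]^_ : ℕ → Row
([2+x][1+x]^ n) e = + 2 * ([1+x]^ n) e + 1ℤ * X ([1+x]^ n) e

-- Rows 2m and 2m+1 of the staircase carry the same power (1+x)^(n-m), so twice the former plus the
-- latter produces the factor 2+x.
TN-odd-seeds : ∀ n → TN (seeds [2+x][1+x]^_ n)
TN-odd-seeds n = TN-cong same (TN-select {E′} (λ m → m ℕ.+ m) double-<
  (TN-bidiagonal {E} {E′} (λ s → 2 , 1 , λ e → refl) (TN-staircase n n)))
  where
  E E′ : ℕ → Row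
  E a = suc a ^X ([1+x]^ (n ⊓ (n ∸ ⌊ a /2⌋)))
  E′ a e = + 2 * E a e + 1ℤ * E (suc a) e
  same : ∀ m → E′ (m ℕ.+ m) ≗ seeds [2+x][1+x]^_ n m
  same m e rewrite sym (ℕₚ.n≡⌊n+n/2⌋ m) | sym (ℕₚ.n≡⌈n+n/2⌉ m) | ℕₚ.m≥n⇒m⊓n≡n (ℕₚ.m∸n≤m n m) = sym (trans
    (^X-linear (suc (m ℕ.+ m)) (+ 2) 1ℤ ([1+x]^ (n ∸ m)) (X ([1+x]^ (n ∸ m))) e)
    (cong (λ z → + 2 * (suc (m ℕ.+ m) ^X ([1+x]^ (n ∸ m))) e + 1ℤ * z)
      (^X-X (suc (m ℕ.+ m)) ([1+x]^ (n ∸ m)) e)))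

-- delay t w prepends t zero weights, so that the rows before t are left alone.
delay : ℕ → (ℕ → ℕ) → ℕ → ℕ
delay zero    w m       = w m
delay (suc t) w zero    = 0
delay (suc t) w (suc m) = delay t w m

-- One round leaves the rows up to t unchanged; from row t on it builds the rows q
-- from the rows p of the previous round, and from these the next rows p.
transform : (ℕ → ℕ) → ℕ → ℕ → (ℕ → Row) → ℕ → Row
transform w zero    t A = A
transform w (suc T) t A = accumulate (delay t (const 1)) (accumulate (delay t w) (transform w T (suc t) A))

TN-transform : ∀ w T t {A} → TN A → TN (transform w T t A)
TN-transform w zero    t tn = tn
TN-transform w (suc T) t tn = TN-accumulate _ (TN-accumulate _ (TN-transform w T (suc t) tn))

accumulate-cong : ∀ w {A B : ℕ → Row} → (∀ m → A m ≗ B m) → ∀ m → accumulate w A m ≗ accumulate w B m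
accumulate-cong w A≗B zero    e = A≗B zero e
accumulate-cong w A≗B (suc m) e =
  cong₂ (λ a b → + w m * a + b) (accumulate-cong w A≗B m e) (A≗B (suc m) e)

accumulate-X : ∀ w A m → accumulate w (X ∘ A) m ≗ X (accumulate w A m)
accumulate-X w A zero    e = refl
accumulate-X w A (suc m) zero    rewrite accumulate-X w A m zero = vanish (+ w m)
  where
  vanish : ∀ a → a * 0ℤ + 0ℤ ≡ 0ℤ
  vanish = solve-∀
accumulate-X w A (suc m) (suc e) = cong (λ a → + w m * a + A (suc m) e) (accumulate-X w A m (suc e))

-- The prepended zero weight decouples row `zero` from the rows after it.
accumulate-delay : ∀ t w A m → accumulate (delay (suc t) w) A (suc m) ≗ accumulate (delay t w) (A ∘ suc) m
accumulate-delay t w A zero    e = drop (A 0 e) (A 1 e)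
  where
  drop : ∀ a b → 0ℤ * a + b ≡ b
  drop = solve-∀
accumulate-delay t w A (suc m) e =
  cong (λ a → + delay t w m * a + A (suc (suc m)) e) (accumulate-delay t w A m e)

transform-cong : ∀ w T t {A B : ℕ → Row} → (∀ m → A m ≗ B m) → ∀ m → transform w T t A m ≗ transform w T t B m
transform-cong w zero    t A≗B = A≗B
transform-cong w (suc T) t A≗B = accumulate-cong _ (accumulate-cong _ (transform-cong w T (suc t) A≗B))

transform-X : ∀ w T t A m → transform w T t (X ∘ A) m ≗ X (transform w T t A m)
transform-X w zero    t A m e = refl
transform-X w (suc T) t A m e = trans
  (accumulate-cong _ (accumulate-cong _ (transform-X w T (suc t) A)) m e) (trans
  (accumulate-cong _ (accumulate-X (delay t w) (transform w T (suc t) A)) m e)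
  (accumulate-X (delay t (const 1)) (accumulate (delay t w) (transform w T (suc t) A)) m e))

transform-head : ∀ w T t A → transform w T (suc t) A zero ≗ A zero
transform-head w zero    t A e = refl
transform-head w (suc T) t A e = transform-head w T (suc t) A e

-- Self-similarity of the rounds: together with `seeds-tail` and `transform-X` it turns the later
-- rows for n+1 into x^2 times the rows for n.
transform-tail : ∀ w T t A m → transform w T (suc t) A (suc m) ≗ transform w T t (A ∘ suc) m
transform-tail w zero    t A m e = refl
transform-tail w (suc T) t A m e = trans
  (accumulate-delay t (const 1) (accumulate (delay (suc t) w) Z) m e)
  (accumulate-cong (delay t (const 1)) (λ m e → trans
    (accumulate-delay t w Z m e)
    (accumulate-cong (delay t w) (transform-tail w T (suc t) A) m e)) m e)
  where
  Z : ℕ → Row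
  Z = transform w T (suc (suc t)) A

-- Closed form of the transformed rows

first : ℕ → ℕ → ℕ
first c zero    = c
first c (suc m) = 1

-- With k = n - m, p n m is `suc (ε + n + m) [-] k` and q n m is `(ε + n + m) [+] k`.
_[+]_ _[-]_ : ℕ → ℕ → Row
(a [+] b) e = 1ℤ * ([1+x]^ a) e + 1ℤ * ([1+x]^ b) e
(a [-] b) e = 1ℤ * ([1+x]^ a) e + -1ℤ * ([1+x]^ b) e

-- The recursion for q multiplied by x: the terms in (1+x)^k combine by (1+x) - x = 1.
XX-step : ∀ a k e → 1ℤ * X (a [+] suc k) e + X (X (a [-] k)) e ≡ X (suc a [+] k) e
XX-step a k zero    = refl
XX-step a k (suc e) = begin
  1ℤ * (1ℤ * u + 1ℤ * (1ℤ * v + 1ℤ * v′)) + X (a [-] k) e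
    ≡⟨ cong (_+_ (1ℤ * (1ℤ * u + 1ℤ * (1ℤ * v + 1ℤ * v′)))) (X-linear 1ℤ -1ℤ ([1+x]^ a) ([1+x]^ k) e) ⟩
  1ℤ * (1ℤ * u + 1ℤ * (1ℤ * v + 1ℤ * v′)) + (1ℤ * u′ + -1ℤ * v′)
    ≡⟨ collect u u′ v v′ ⟩
  1ℤ * (1ℤ * u + 1ℤ * u′) + 1ℤ * v ∎
  where
  open ≡-Reasoning
  u = ([1+x]^ a) e
  u′ = X ([1+x]^ a) e
  v = ([1+x]^ k) e
  v′ = X ([1+x]^ k) e
  collect : ∀ u u′ v v′ → 1ℤ * (1ℤ * u + 1ℤ * (1ℤ * v + 1ℤ * v′)) + (1ℤ * u′ + -1ℤ * v′)
    ≡ 1ℤ * (1ℤ * u + 1ℤ * u′) + 1ℤ * v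
  collect = solve-∀

-- The recursion for p: the terms in (1+x)^k combine by -(1+x) + x = -1.
X-step : ∀ a k e → 1ℤ * (a [-] suc k) e + X (a [+] k) e ≡ (suc a [-] k) e
X-step a k e = begin
  1ℤ * (1ℤ * u + -1ℤ * (1ℤ * v + 1ℤ * v′)) + X (a [+] k) e
    ≡⟨ cong (_+_ (1ℤ * (1ℤ * u + -1ℤ * (1ℤ * v + 1ℤ * v′)))) (X-linear 1ℤ 1ℤ ([1+x]^ a) ([1+x]^ k) e) ⟩
  1ℤ * (1ℤ * u + -1ℤ * (1ℤ * v + 1ℤ * v′)) + (1ℤ * u′ + 1ℤ * v′)
    ≡⟨ collect u u′ v v′ ⟩
  1ℤ * (1ℤ * u + 1ℤ * u′) + -1ℤ * v ∎
  where
  open ≡-Reasoning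
  u = ([1+x]^ a) e
  u′ = X ([1+x]^ a) e
  v = ([1+x]^ k) e
  v′ = X ([1+x]^ k) e
  collect : ∀ u u′ v v′ → 1ℤ * (1ℤ * u + -1ℤ * (1ℤ * v + 1ℤ * v′)) + (1ℤ * u′ + 1ℤ * v′)
    ≡ 1ℤ * (1ℤ * u + 1ℤ * u′) + -1ℤ * v
  collect = solve-∀

-- In the notation above, the hypotheses say that x g n = p n 0 and c g n = q n 0.
module _ (ε c : ℕ) (g : ℕ → Row)
  (Xg : ∀ n → X (g n) ≗ suc (ε ℕ.+ n) [-] n)
  (cg : ∀ n e → + c * g n e ≡ ((ε ℕ.+ n) [+] n) e) where

  private
    w : ℕ → ℕ
    w = first c
    inner : ℕ → ℕ → ℕ → Row
    inner T n = accumulate w (transform w T 1 (seeds g n))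

  seeds-tail : ∀ n m → seeds g (suc n) (suc m) ≗ X (X (seeds g n m))
  seeds-tail n m e = cong (λ a → (suc a ^X g (n ∸ m)) e) (cong suc (ℕₚ.+-suc m m))

  -- `T` rounds make the rows up to `T` correct. Here `k` is n - m, given additively to avoid
  -- truncated subtraction.
  Closed : ℕ → Set
  Closed T = ∀ {n} m k → m ≤ T → n ≡ m ℕ.+ k →
    transform w T 0 (seeds g n) m ≗ suc (ε ℕ.+ n ℕ.+ m) [-] k

  -- The inner accumulation starts from x g n, which is x q n 0 divided by `c`. Its first weight `c`
  -- repairs this, so the weighted rows have a uniform formula. Each further row adds x^2 p (n-1) m,
  -- known from the previous round, as in `XX-step`.
  inner-closed : ∀ T → Closed T → ∀ {n} m k → m ≤ suc T → n ≡ m ℕ.+ k →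
    ∀ e → + w m * inner T n m e ≡ X ((ε ℕ.+ n ℕ.+ m) [+] k) e
  inner-closed T closed {n} zero k _ refl e = begin
    + c * transform w T 1 (seeds g n) zero e ≡⟨ cong (+ c *_) (transform-head w T 0 (seeds g n) e) ⟩
    + c * X (g n) e                          ≡⟨ scale e ⟩
    X ((ε ℕ.+ n) [+] n) e                    ≡⟨ cong (λ a → X (a [+] n) e) (ℕₚ.+-identityʳ (ε ℕ.+ n)) ⟨
    X ((ε ℕ.+ n ℕ.+ 0) [+] n) e              ∎
    where
    open ≡-Reasoning
    scale : ∀ e → + c * X (g n) e ≡ X ((ε ℕ.+ n) [+] n) e
    scale zero    = ℤₚ.*-zeroʳ (+ c)
    scale (suc e) = cg n e
  inner-closed T closed {suc n} (suc m) k (s≤s m≤T) refl e = begin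
    1ℤ * inner T (suc n) (suc m) e
      ≡⟨ ℤₚ.*-identityˡ (inner T (suc n) (suc m) e) ⟩
    + w m * inner T (suc n) m e + transform w T 1 (seeds g (suc n)) (suc m) e
      ≡⟨ cong₂ _+_ (inner-closed T closed m (suc k) (ℕₚ.m≤n⇒m≤1+n m≤T) (sym (ℕₚ.+-suc m k)) e) tail ⟩
    X (a [+] suc k) e + X (X (a [-] k)) e
      ≡⟨ cong (_+ X (X (a [-] k)) e) (ℤₚ.*-identityˡ (X (a [+] suc k) e)) ⟨
    1ℤ * X (a [+] suc k) e + X (X (a [-] k)) e
      ≡⟨ XX-step a k e ⟩
    X (suc a [+] k) e
      ≡⟨ cong (λ a → X (a [+] k) e) (ℕₚ.+-suc (ε ℕ.+ suc n) m) ⟨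
    X ((ε ℕ.+ suc n ℕ.+ suc m) [+] k) e ∎
    where
    open ≡-Reasoning
    a = ε ℕ.+ suc n ℕ.+ m
    -- Drop the first row, pull x^2 out of the seeds, and apply the closed form for n.
    tail : transform w T 1 (seeds g (suc n)) (suc m) e ≡ X (X (a [-] k)) e
    tail = begin
      transform w T 1 (seeds g (suc n)) (suc m) e
        ≡⟨ transform-tail w T 0 (seeds g (suc n)) m e ⟩
      transform w T 0 (seeds g (suc n) ∘ suc) m e
        ≡⟨ transform-cong w T 0 (seeds-tail n) m e ⟩
      transform w T 0 (X ∘ X ∘ seeds g n) m e
        ≡⟨ transform-X w T 0 (X ∘ seeds g n) m e ⟩
      X (transform w T 0 (X ∘ seeds g n) m) e
        ≡⟨ X-cong (transform-X w T 0 (seeds g n) m) e ⟩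
      X (X (transform w T 0 (seeds g n) m)) e
        ≡⟨ X-cong (X-cong (closed m k m≤T refl)) e ⟩
      X (X (suc (ε ℕ.+ n ℕ.+ m) [-] k)) e
        ≡⟨ cong (λ a → X (X ((a ℕ.+ m) [-] k)) e) (ℕₚ.+-suc ε n) ⟨
      X (X (a [-] k)) e ∎

  -- Row `zero` is never altered and equals x g n = p n 0. Each later row adds x q n (m+1) to p n m,
  -- as in `X-step`.
  closed : ∀ T → Closed T
  closed zero    {n} zero k _ refl e =
    trans (Xg n e) (cong (λ a → (suc a [-] n) e) (sym (ℕₚ.+-identityʳ (ε ℕ.+ n))))
  closed (suc T) {n} zero k _ refl e = trans (transform-head w T 0 (seeds g n) e)
    (trans (Xg n e) (cong (λ a → (suc a [-] n) e) (sym (ℕₚ.+-identityʳ (ε ℕ.+ n)))))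
  closed (suc T) {n} (suc m) k m<T n≡ e = begin
    1ℤ * transform w (suc T) 0 (seeds g n) m e + inner T n (suc m) e
      ≡⟨ cong₂ (λ u v → 1ℤ * u + v)
           (closed (suc T) m (suc k) (ℕₚ.<⇒≤ m<T) (trans n≡ (sym (ℕₚ.+-suc m k))) e)
           (trans (sym (ℤₚ.*-identityˡ (inner T n (suc m) e))) (inner-closed T (closed T) (suc m) k m<T n≡ e)) ⟩
    1ℤ * (suc (ε ℕ.+ n ℕ.+ m) [-] suc k) e + X ((ε ℕ.+ n ℕ.+ suc m) [+] k) e
      ≡⟨ cong (λ a → 1ℤ * (a [-] suc k) e + X ((ε ℕ.+ n ℕ.+ suc m) [+] k) e) (ℕₚ.+-suc (ε ℕ.+ n) m) ⟨
    1ℤ * ((ε ℕ.+ n ℕ.+ suc m) [-] suc k) e + X ((ε ℕ.+ n ℕ.+ suc m) [+] k) e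
      ≡⟨ X-step (ε ℕ.+ n ℕ.+ suc m) k e ⟩
    (suc (ε ℕ.+ n ℕ.+ suc m) [-] k) e ∎
    where open ≡-Reasoning

  TN-M : (∀ n → TN (seeds g n)) → ∀ d → d ≡ ε ℕ.+ (⌊ d /2⌋ ℕ.+ ⌊ d /2⌋) → TotallyNonnegative (M d)
  TN-M TN-seeds d d≡ k _ r s r↑ s↑ = subst (0ℤ ℤ.≤_) (det-cong entry)
    -- The reversals i ↦ n - i and j ↦ d - j turn increasing selections into decreasing ones. Row
    -- indices are at most `n`, so `n` rounds suffice.
    (TN-transform w n 0 (TN-seeds n) k (λ i → n ∸ toℕ (r i)) (λ j → d ∸ toℕ (s j))
      (λ i j i<j → ℕₚ.∸-monoʳ-< {n} (r↑ i<j) (r≤n j))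
      (λ i j i<j → ℕₚ.∸-monoʳ-< {d} (s↑ i<j) (ℕₚ.<⇒≤ (toℕ<n (s j)))))
    where
    open ≡-Reasoning
    n = ⌊ d /2⌋
    r≤n : ∀ i → toℕ (r i) ≤ n
    r≤n i = ℕₚ.≤-pred (subst (toℕ (r i) ℕ.<_) (ℕₚ.+-comm n 1) (toℕ<n (r i)))
    normalise : ∀ u v → 1ℤ * u + -1ℤ * v ≡ u - v
    normalise = solve-∀
    exponent : ∀ i → suc (ε ℕ.+ n ℕ.+ (n ∸ toℕ (r i))) ≡ d ℕ.+ 1 ∸ toℕ (r i)
    exponent i = begin
      suc (ε ℕ.+ n) ℕ.+ (n ∸ toℕ (r i)) ≡⟨ ℕₚ.+-∸-assoc (suc (ε ℕ.+ n)) (r≤n i) ⟨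
      suc (ε ℕ.+ n ℕ.+ n) ∸ toℕ (r i)   ≡⟨ cong (λ a → suc a ∸ toℕ (r i)) (trans (ℕₚ.+-assoc ε n n) (sym d≡)) ⟩
      suc d ∸ toℕ (r i)                 ≡⟨ cong (_∸ toℕ (r i)) (ℕₚ.+-comm d 1) ⟨
      d ℕ.+ 1 ∸ toℕ (r i)               ∎
    entry : ∀ i j → transform w n 0 (seeds g n) (n ∸ toℕ (r i)) (d ∸ toℕ (s j)) ≡ M d (r i) (s j)
    entry i j = begin
      transform w n 0 (seeds g n) (n ∸ toℕ (r i)) e
        ≡⟨ closed n (n ∸ toℕ (r i)) (toℕ (r i)) (ℕₚ.m∸n≤m n (toℕ (r i))) (sym (ℕₚ.m∸n+n≡m (r≤n i))) e ⟩
      (suc (ε ℕ.+ n ℕ.+ (n ∸ toℕ (r i))) [-] toℕ (r i)) e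
        ≡⟨ cong (λ a → (a [-] toℕ (r i)) e) (exponent i) ⟩
      ((d ℕ.+ 1 ∸ toℕ (r i)) [-] toℕ (r i)) e
        ≡⟨ normalise (([1+x]^ (d ℕ.+ 1 ∸ toℕ (r i))) e) (([1+x]^ toℕ (r i)) e) ⟩
      ([1+x]^ (d ℕ.+ 1 ∸ toℕ (r i))) e - ([1+x]^ toℕ (r i)) e
        ≡⟨ cong₂ _-_ ([1+x]^-coefficient (d ℕ.+ 1 ∸ toℕ (r i)) e) ([1+x]^-coefficient (toℕ (r i)) e) ⟩
      M d (r i) (s j) ∎
      where
      e = d ∸ toℕ (s j)

-- The two parities of d

parity : ∀ d → d ≡ ⌊ d /2⌋ ℕ.+ ⌊ d /2⌋ ⊎ d ≡ suc (⌊ d /2⌋ ℕ.+ ⌊ d /2⌋)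
parity zero          = inj₁ refl
parity (suc zero)    = inj₂ refl
parity (suc (suc d)) with parity d
... | inj₁ even = inj₁ (cong suc (trans (cong suc even) (sym (ℕₚ.+-suc ⌊ d /2⌋ ⌊ d /2⌋))))
... | inj₂ odd  = inj₂ (cong suc (cong suc (trans odd (sym (ℕₚ.+-suc ⌊ d /2⌋ ⌊ d /2⌋)))))

theorem2p1 : (d : ℕ) → 1 ≤ d → TotallyNonnegative (M d)
theorem2p1 d _ with parity d
-- p n 0 = (1+x)^(n+1) - (1+x)^n = x (1+x)^n, while q n 0 = 2 (1+x)^n, hence the weight 2.
... | inj₁ even = TN-M 0 2 [1+x]^_
  (λ n e → even-X (([1+x]^ n) e) (X ([1+x]^ n) e))
  (λ n e → even-double (([1+x]^ n) e))
  TN-even-seeds d even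
  where
  even-X : ∀ u u′ → u′ ≡ 1ℤ * (1ℤ * u + 1ℤ * u′) + -1ℤ * u
  even-X = solve-∀
  even-double : ∀ u → + 2 * u ≡ 1ℤ * u + 1ℤ * u
  even-double = solve-∀
-- p n 0 = (1+x)^(n+2) - (1+x)^n = x (2+x) (1+x)^n, and q n 0 = (1+x)^(n+1) + (1+x)^n = (2+x)
-- (1+x)^n, hence the weight 1.
... | inj₂ odd  = TN-M 1 1 [2+x][1+x]^_
  odd-X
  (λ n e → odd-sum (([1+x]^ n) e) (X ([1+x]^ n) e))
  TN-odd-seeds d odd
  where
  open ≡-Reasoning
  collect : ∀ u u′ u″ → + 2 * u′ + 1ℤ * u″ ≡
    1ℤ * (1ℤ * (1ℤ * u + 1ℤ * u′) + 1ℤ * (1ℤ * u′ + 1ℤ * u″)) + -1ℤ * u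
  collect = solve-∀
  odd-X : ∀ n → X ([2+x][1+x]^ n) ≗ suc (suc n) [-] n
  odd-X n e = begin
    X ([2+x][1+x]^ n) e
      ≡⟨ X-linear (+ 2) 1ℤ ([1+x]^ n) (X ([1+x]^ n)) e ⟩
    + 2 * X ([1+x]^ n) e + 1ℤ * X (X ([1+x]^ n)) e
      ≡⟨ collect (([1+x]^ n) e) (X ([1+x]^ n) e) (X (X ([1+x]^ n)) e) ⟩
    1ℤ * (1ℤ * ([1+x]^ suc n) e + 1ℤ * (1ℤ * X ([1+x]^ n) e + 1ℤ * X (X ([1+x]^ n)) e)) + -1ℤ * ([1+x]^ n) e
      ≡⟨ cong (λ z → 1ℤ * (1ℤ * ([1+x]^ suc n) e + 1ℤ * z) + -1ℤ * ([1+x]^ n) e)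
           (X-linear 1ℤ 1ℤ ([1+x]^ n) (X ([1+x]^ n)) e) ⟨
    (suc (suc n) [-] n) e ∎
  odd-sum : ∀ u u′ → 1ℤ * (+ 2 * u + 1ℤ * u′) ≡ 1ℤ * (1ℤ * u + 1ℤ * u′) + 1ℤ * u
  odd-sum = solve-∀
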